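{- Let $r\ge 2$, let $H$ be a digraph (possibly with loops) and let $D$ be an $H$-colored $r$-partite tournament. If $k \geq 5$, then $D$ has a $(k,H)$-kernel.
   Context: All digraphs are finite. An $r$-partite tournament is a digraph whose vertex set is partitioned into $r$ disjoint independent sets such that every two vertices in different classes are joined by exactly one arc (an asymmetric arc). $D$ has no loops and comes with a map $\rho: A(D)\to V(H)$. For a walk $W=(x_0,\ldots,x_n)$ in $D$, there is an obstruction on $x_i$ if $(\rho(x_{i-1},x_i),\rho(x_i,x_{i+1})) \notin A(H)$; for an open walk this is considered at internal vertices $x_i$, $1\le i\le n-1$, for a closed walk at all $i\in\{0,\ldots,n-1\}$ with indices modulo $n$. $O_H(W)$ is the set of indices with an obstruction; the $H$-length is $l_H(W)=|O_H(W)|+1$ for open $W$ and $|O_H(W)|$ for closed $W$. A $(k,H)$-kernel ($k\ge2$) is a set $S\subseteq V(D)$ such that for every two distinct $u,v\in S$ every directed $uv$-path in $D$ has $H$-length at least $k$, and for every $x\in V(D)\setminus S$ there is a directed path from $x$ to a vertex of $S$ of $H$-length at most $k-1$. -}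

module Defs where

open import Data.Bool using (Bool; T; if_then_else_)
open import Data.Fin using (Fin)
open import Data.Fin.Subset using (Subset; _∈_; _∉_)
open import Data.List using (List; []; _∷_; length; map)
open import Data.List.Relation.Unary.Unique.Propositional using (Unique)
open import Data.Nat using (ℕ; suc; _∸_; _≤_)
open import Data.Product using (_×_; ∃; ∃-syntax)
open import Data.Sum using (_⊎_)
open import Relation.Binary.Construct.Closure.ReflexiveTransitive using (Star; ε; _◅_)
open import Relation.Binary.PropositionalEquality using (_≡_; _≢_)
open import Relation.Nullary using (¬_)

-- Finite digraphs without parallel arcs; loops are allowed.
record Digraph : Set where
  field
    order : ℕ
    arc?  : Fin order → Fin order → Bool

  Vertex : Set
  Vertex = Fin order

  Arc : Vertex → Vertex → Set
  Arc u v = T (arc? u v)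

  -- A walk (x₀, …, xₙ) is given by its consecutive arcs.
  Walk : Vertex → Vertex → Set
  Walk = Star Arc

  vertices : ∀ {u v} → Walk u v → List Vertex
  vertices {u} ε       = u ∷ []
  vertices {u} (_ ◅ W) = u ∷ vertices W

  IsPath : ∀ {u v} → Walk u v → Set
  IsPath W = Unique (vertices W)

open Digraph public

-- Classes may be empty.  Absence of loops and of symmetric arcs follows from
-- the two axioms.
record IsPartiteTournament (r : ℕ) (D : Digraph) : Set where
  field
    class       : Vertex D → Fin r
    independent : ∀ {u v} → class u ≡ class v → ¬ Arc D u v
    exactlyOne  : ∀ {u v} → class u ≢ class v →
                  (Arc D u v × ¬ Arc D v u) ⊎ (¬ Arc D u v × Arc D v u)

Coloring : Digraph → Digraph → Set
Coloring H D = ∀ {u v} → Arc D u v → Vertex H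

module _ (H D : Digraph) (ρ : Coloring H D) where

  -- The set O_H(W) for an open walk W = (x₀, …, xₙ), as a duplicate-free list
  -- of indices i with 1 ≤ i ≤ n ∸ 1.
  obstructions : ∀ {u v} → Walk D u v → List ℕ
  obstructions ε           = []
  obstructions (a ◅ ε)     = []
  obstructions (a ◅ b ◅ W) =
    let later = map suc (obstructions (b ◅ W)) in
    if arc? H (ρ a) (ρ b) then later else 1 ∷ later

  -- The H-length of an open walk.  Closed walks follow a different convention,
  -- but only paths between distinct vertices occur in the definition of a kernel.
  hLength : ∀ {u v} → Walk D u v → ℕ
  hLength W = suc (length (obstructions W))

  record IsKernel (k : ℕ) (S : Subset (order D)) : Set where
    field
      independent : ∀ {u v} → u ∈ S → v ∈ S → u ≢ v →
                    (P : Walk D u v) → IsPath D P → k ≤ hLength P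
      absorbent   : ∀ {x} → x ∉ S →
                    ∃[ y ] y ∈ S × ∃[ P ] IsPath D {x} {y} P × hLength P ≤ k ∸ 1

  HasKernel : ℕ → Set
  HasKernel k = ∃ (IsKernel k)

{-# OPTIONS --safe #-}
module Submission where

open import Data.Bool using (true; false)
open import Data.Bool.Properties using (T-≡)
open import Data.Fin using (Fin)
import Data.Fin.Properties as Fin
open import Data.Fin.Subset using (Subset; _∈_; ⊥; ⁅_⁆)
open import Data.Fin.Subset.Properties using (∉⊥; x∈⁅x⁆; x∈⁅y⁆⇒x≡y)
open import Data.List using (List; []; _∷_; length; filter; allFin)
open import Data.List.Membership.Propositional using (find; lose) renaming (_∈_ to _∈ˡ_)
open import Data.List.Membership.Propositional.Properties using (∈-filter⁺; ∈-filter⁻; ∈-allFin)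
open import Data.List.Properties using (length-filter; length-map)
open import Data.List.Relation.Unary.All using ([]; _∷_)
open import Data.List.Relation.Unary.All.Properties using (¬Any⇒All¬)
open import Data.List.Relation.Unary.AllPairs using ([]; _∷_)
open import Data.List.Relation.Unary.Any using (here; there; any?)
open import Data.Nat using (ℕ; suc; _+_; _∸_; _≤_; _<_; _≥_; z≤n; s≤s)
open import Data.Nat.Induction using (Acc; acc; <-wellFounded)
open import Data.Nat.Properties using (≤-refl; ≤-trans; m≤n⇒m≤1+n; m≤n⇒m≤o+n; ∸-monoˡ-≤)
open import Data.Product using (_×_; _,_; proj₁; proj₂; ∃-syntax; Σ-syntax)
open import Data.Sum using (_⊎_; inj₁; inj₂)
open import Data.Unit using (⊤; tt)
open import Data.Vec using (tabulate)
open import Data.Vec.Properties using (lookup⇒[]=; []=⇒lookup; lookup∘tabulate)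
open import Defs
open import Function using (_∘_; Equivalence)
open import Relation.Binary.Construct.Closure.ReflexiveTransitive using (ε; _◅_)
open import Relation.Binary.PropositionalEquality using (_≡_; _≢_; refl; sym; trans)
open import Relation.Nullary using (¬_; Dec; yes; no; contradiction; isYes)
open import Relation.Nullary.Decidable using (T?; ¬?; _→-dec_; toWitness; fromWitness)
open import Relation.Unary using (Decidable)

-- If D has a sink, the sinks form a kernel: they all lie in one class, and any
-- other vertex reaches a sink in at most two steps.  Otherwise a single vertex,
-- reached from everywhere in at most four steps, is a kernel (Gutin, and
-- Petrovic and Thomassen, in the reversed digraph).  It is found as follows.
-- A quasi-kernel Q (Chvátal and Lovász) is independent and is reached from
-- everywhere in at most two steps.  Choose q ∈ Q whose in-neighbourhood is
-- maximal for inclusion among the members of Q.  Since Q lies in one class, each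
-- p ∈ Q either reaches q in two steps or has the same in-neighbours as q, and in
-- the latter case also the same out-neighbours.  As the H-length of a path is at
-- most its number of arcs, the colouring plays no role.

-- Decidable subsets and maximal elements

comprehension : ∀ {n p} {P : Fin n → Set p} → Decidable P →
                Σ[ S ∈ Subset n ] (∀ {x} → x ∈ S → P x) × (∀ {x} → P x → x ∈ S)
comprehension {n} {P = P} P? = S , sound , complete
  where
  S : Subset n
  S = tabulate (isYes ∘ P?)

  sound : ∀ {x} → x ∈ S → P x
  sound {x} x∈S = toWitness {a? = P? x}
    (Equivalence.from T-≡ (trans (sym (lookup∘tabulate (isYes ∘ P?) x)) ([]=⇒lookup x∈S)))

  complete : ∀ {x} → P x → x ∈ S
  complete {x} Px = lookup⇒[]= x S
    (trans (lookup∘tabulate (isYes ∘ P?) x) (Equivalence.to T-≡ (fromWitness {a? = P? x} Px)))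

maximal : ∀ {a ℓ} {A : Set a} {_≼_ : A → A → Set ℓ} →
          (∀ x y → Dec (x ≼ y)) → (∀ {x} → x ≼ x) → (∀ {x y z} → x ≼ y → y ≼ z → x ≼ z) →
          ∀ x xs → ∃[ m ] m ∈ˡ x ∷ xs × (∀ {y} → y ∈ˡ x ∷ xs → m ≼ y → y ≼ m)
maximal _≼?_ rfl trn x [] = x , here refl , λ { (here refl) _ → rfl }
maximal _≼?_ rfl trn x (x′ ∷ xs) with maximal _≼?_ rfl trn x′ xs
... | m , m∈ , max with m ≼? x
-- The head replaces `m` only if `m ≼ x`. Anything in the tail above `x` is then above `m`, hence
-- below `m` and so below `x`.
... | yes m≼x = x , here refl ,
      λ { (here refl) _ → rfl ; (there y∈) x≼y → trn (max y∈ (trn m≼x x≼y)) m≼x }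
... | no m⋠x = m , there m∈ ,
      λ { (here refl) m≼x → contradiction m≼x m⋠x ; (there y∈) → max y∈ }

-- Walks of bounded length

module _ (D : Digraph) where

  -- As `stop` is available at every index, the index is an upper bound on the number of arcs.
  -- Vertices may repeat, so walks concatenate freely.
  data Reaches : ℕ → Vertex D → Vertex D → Set where
    stop : ∀ {n x} → Reaches n x x
    step : ∀ {n x y z} → Arc D x y → Reaches n y z → Reaches (suc n) x z

  reaches-mono : ∀ {m n x y} → m ≤ n → Reaches m x y → Reaches n x y
  reaches-mono _         stop       = stop
  reaches-mono (s≤s m≤n) (step a R) = step a (reaches-mono m≤n R)

  reaches-trans : ∀ {m n x y z} → Reaches m x y → Reaches n y z → Reaches (m + n) x z
  reaches-trans {m} stop       R′ = reaches-mono (m≤n⇒m≤o+n m ≤-refl) R′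
  reaches-trans     (step a R) R′ = step a (reaches-trans R R′)

  suffixFrom : ∀ {x y w} (W : Walk D x y) → IsPath D W → w ∈ˡ vertices D W →
               Σ[ W′ ∈ Walk D w y ] IsPath D W′ × length (vertices D W′) ≤ length (vertices D W)
  suffixFrom ε       P       (here refl) = ε , P , ≤-refl
  suffixFrom (a ◅ W) P       (here refl) = a ◅ W , P , ≤-refl
  suffixFrom (a ◅ W) (_ ∷ P) (there w∈W) with suffixFrom W P w∈W
  ... | W′ , P′ , W′≤W = W′ , P′ , m≤n⇒m≤1+n W′≤W

  -- If the new first vertex already occurs on the path built from the rest, the suffix starting
  -- there cuts out the closed part.
  reaches⇒path : ∀ {n x y} → Reaches n x y →
                 Σ[ W ∈ Walk D x y ] IsPath D W × length (vertices D W) ≤ suc n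
  reaches⇒path stop = ε , [] ∷ [] , s≤s z≤n
  reaches⇒path (step {x = x} a R) with reaches⇒path R
  ... | W , P , ∣W∣≤ with any? (x Fin.≟_) (vertices D W)
  ... | no x∉W = a ◅ W , ¬Any⇒All¬ _ x∉W ∷ P , s≤s ∣W∣≤
  ... | yes x∈W with suffixFrom W P x∈W
  ... | W′ , P′ , W′≤W = W′ , P′ , ≤-trans W′≤W (m≤n⇒m≤1+n ∣W∣≤)

  -- Quasi-kernels

  arcDec : ∀ u v → Dec (Arc D u v)
  arcDec u v = T? (arc? D u v)

  -- Recursion on the tail with the in-neighbours of `v` removed. If `v` has an arc into the
  -- resulting `Q`, then `Q` serves again, since the removed vertices reach it through `v`.
  -- Otherwise `v` joins `Q`: it sends no arc into `Q`, and `Q` contains none of its in-neighbours.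
  quasiKernel : (∀ {v} → ¬ Arc D v v) → ∀ X → Acc _<_ (length X) →
                ∃[ Q ] (∀ {q} → q ∈ˡ Q → q ∈ˡ X) ×
                       (∀ {p q} → p ∈ˡ Q → q ∈ˡ Q → ¬ Arc D p q) ×
                       (∀ {x} → x ∈ˡ X → ∃[ q ] q ∈ˡ Q × Reaches 2 x q)
  quasiKernel loopless [] _ = [] , (λ ()) , (λ ()) , (λ ())
  quasiKernel loopless (v ∷ X) (acc rs)
    with quasiKernel loopless (filter (λ x → ¬? (arcDec x v)) X)
                     (rs (s≤s (length-filter (λ x → ¬? (arcDec x v)) X)))
  ... | Q , Q⊆ , indep , absorb with any? (arcDec v) Q
  ... | yes v→Q with find v→Q
  ... | q , q∈Q , v→q =
    Q , there ∘ proj₁ ∘ ∈-filter⁻ (λ x → ¬? (arcDec x v)) ∘ Q⊆ , indep , absorb′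
    where
    absorb′ : ∀ {x} → x ∈ˡ v ∷ X → ∃[ p ] p ∈ˡ Q × Reaches 2 x p
    absorb′ (here refl) = q , q∈Q , step v→q stop
    absorb′ {x} (there x∈X) with arcDec x v
    ... | yes x→v = q , q∈Q , step x→v (step v→q stop)
    ... | no x↛v  = absorb (∈-filter⁺ (λ x → ¬? (arcDec x v)) x∈X x↛v)
  quasiKernel loopless (v ∷ X) (acc rs)
      | Q , Q⊆ , indep , absorb | no v↛Q = v ∷ Q , Q′⊆ , indep′ , absorb′
    where
    Q′⊆ : ∀ {q} → q ∈ˡ v ∷ Q → q ∈ˡ v ∷ X
    Q′⊆ (here q≡v)  = here q≡v
    Q′⊆ (there q∈Q) = there (proj₁ (∈-filter⁻ (λ x → ¬? (arcDec x v)) (Q⊆ q∈Q)))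

    indep′ : ∀ {p q} → p ∈ˡ v ∷ Q → q ∈ˡ v ∷ Q → ¬ Arc D p q
    indep′ (here refl) (here refl) = loopless
    indep′ (here refl) (there q∈Q) = v↛Q ∘ lose q∈Q
    indep′ (there p∈Q) (here refl) = proj₂ (∈-filter⁻ (λ x → ¬? (arcDec x v)) {xs = X} (Q⊆ p∈Q))
    indep′ (there p∈Q) (there q∈Q) = indep p∈Q q∈Q

    absorb′ : ∀ {x} → x ∈ˡ v ∷ X → ∃[ p ] p ∈ˡ v ∷ Q × Reaches 2 x p
    absorb′ (here refl) = v , here refl , stop
    absorb′ {x} (there x∈X) with arcDec x v
    ... | yes x→v = v , here refl , step x→v stop
    ... | no x↛v with absorb (∈-filter⁺ (λ x → ¬? (arcDec x v)) x∈X x↛v)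
    ... | q , q∈Q , R = q , there q∈Q , R

  -- Sinks and inclusion of in-neighbourhoods

  IsSink : Vertex D → Set
  IsSink x = ∀ y → ¬ Arc D x y

  sink? : Decidable IsSink
  sink? x = Fin.all? (λ y → ¬? (arcDec x y))

  nonSink⇒arc : ∀ {x} → ¬ IsSink x → ∃[ y ] Arc D x y
  nonSink⇒arc {x} ¬sink with Fin.any? (arcDec x)
  ... | yes x→y = x→y
  ... | no ∄    = contradiction (λ y x→y → ∄ (y , x→y)) ¬sink

  -- This order lets a walk whose last arc enters `u` be redirected to end at `v`, with the same
  -- length.
  _≼_ : Vertex D → Vertex D → Set
  u ≼ v = ∀ y → Arc D y u → Arc D y v

  _≼?_ : ∀ u v → Dec (u ≼ v)
  u ≼? v = Fin.all? (λ y → arcDec y u →-dec arcDec y v)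

  -- Multipartite tournaments

  module _ {r : ℕ} (M : IsPartiteTournament r D) where
    open IsPartiteTournament M

    arc⇒class≢ : ∀ {u v} → Arc D u v → class u ≢ class v
    arc⇒class≢ u→v cu≡cv = independent cu≡cv u→v

    ¬arc⇒arc : ∀ {u v} → class u ≢ class v → ¬ Arc D u v → Arc D v u
    ¬arc⇒arc cu≢cv u↛v with exactlyOne cu≢cv
    ... | inj₁ (u→v , _) = contradiction u→v u↛v
    ... | inj₂ (_ , v→u) = v→u

    asym : ∀ {u v} → Arc D u v → ¬ Arc D v u
    asym u→v with exactlyOne (arc⇒class≢ u→v)
    ... | inj₁ (_ , v↛u) = v↛u
    ... | inj₂ (u↛v , _) = contradiction u→v u↛v

    loopless : ∀ {v} → ¬ Arc D v v
    loopless = independent refl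

    nonadjacent⇒class≡ : ∀ {u v} → ¬ Arc D u v → ¬ Arc D v u → class u ≡ class v
    nonadjacent⇒class≡ {u} {v} u↛v v↛u with class u Fin.≟ class v
    ... | yes cu≡cv = cu≡cv
    ... | no cu≢cv  = contradiction (¬arc⇒arc cu≢cv u↛v) v↛u

    -- Some `y` has an arc to `q` but none to `p`. It lies outside their common class, so
    -- `p → y → q`.
    ⋠⇒reaches : ∀ {p q} → class p ≡ class q → ¬ q ≼ p → Reaches 2 p q
    ⋠⇒reaches {p} {q} cp≡cq q⋠p
      with Fin.¬∀⟶∃¬ _ _ (λ y → arcDec y q →-dec arcDec y p) q⋠p
    ... | y , ¬imp with arcDec y q | arcDec y p
    ... | no y↛q  | _       = contradiction (λ y→q → contradiction y→q y↛q) ¬imp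
    ... | yes _   | yes y→p = contradiction (λ _ → y→p) ¬imp
    ... | yes y→q | no y↛p  =
      step (¬arc⇒arc (λ cy≡cp → arc⇒class≢ y→q (trans cy≡cp cp≡cq)) y↛p) (step y→q stop)

    -- The vertex `b` is adjacent to `p`, and `b → p` would give `b → q`, against asymmetry.
    ≼-out : ∀ {p q b} → class p ≡ class q → p ≼ q → Arc D q b → Arc D p b
    ≼-out {b = b} cp≡cq p≼q q→b =
      ¬arc⇒arc (λ cb≡cp → arc⇒class≢ q→b (sym (trans cb≡cp cp≡cq)))
               (λ b→p → asym q→b (p≼q b b→p))

    module _ (noSink : ∀ x → ∃[ y ] Arc D x y)
             {Q : List (Vertex D)}
             (Q-class : ∀ {p q} → p ∈ˡ Q → q ∈ˡ Q → class p ≡ class q)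
             (absorb : ∀ x → ∃[ q ] q ∈ˡ Q × Reaches 2 x q)
             {q : Vertex D} (q∈Q : q ∈ˡ Q)
             (q-max : ∀ {p} → p ∈ˡ Q → q ≼ p → p ≼ q) where

      twin? : ∀ {p} → p ∈ˡ Q → Reaches 2 p q ⊎ p ≼ q
      twin? {p} p∈Q with q ≼? p
      ... | yes q≼p = inj₂ (q-max p∈Q q≼p)
      ... | no q⋠p  = inj₁ (⋠⇒reaches (Q-class p∈Q q∈Q) q⋠p)

      -- Leave `p` by any arc and let `Q` absorb its head `y` at some `p′`. If `p′ ≼ q`, the last
      -- arc is redirected to `q`; otherwise two more arcs lead from `p′` to `q`.
      twin-reaches : ∀ {p} → p ∈ˡ Q → p ≼ q → Reaches 4 p q
      twin-reaches {p} p∈Q p≼q with noSink p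
      ... | y , p→y with absorb y
      -- Here `y` itself would be in `Q`, hence in the class of `p`.
      ... | p′ , p′∈Q , stop = contradiction (Q-class p∈Q p′∈Q) (arc⇒class≢ p→y)
      ... | p′ , p′∈Q , step y→p′ stop with twin? p′∈Q
      ...   | inj₁ p′⇝q = step p→y (step y→p′ p′⇝q)
      ...   | inj₂ p′≼q = step p→y (step (p′≼q _ y→p′) stop)
      twin-reaches {p} p∈Q p≼q | y , p→y | p′ , p′∈Q , step {y = b} y→b (step b→p′ stop)
        with twin? p′∈Q
      ... | inj₂ p′≼q = step p→y (step y→b (step (p′≼q _ b→p′) stop))
      -- The walk p → y → b → p′ ⇝ q has five arcs; it is shortened at b, which is
      -- adjacent to q.
      ... | inj₁ p′⇝q with arcDec b q
      ...   | yes b→q = step p→y (step y→b (step b→q stop))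
      ...   | no b↛q  = step (≼-out (Q-class p∈Q q∈Q) p≼q q→b) (step b→p′ p′⇝q)
        where
        q→b : Arc D q b
        q→b = ¬arc⇒arc (λ cb≡cq → arc⇒class≢ b→p′ (trans cb≡cq (Q-class q∈Q p′∈Q))) b↛q

      -- Two arcs to some `p` in `Q` and two more to `q`; or, if `p ≼ q`, the last arc into `p` is
      -- redirected. Only `x = p` leaves no arc to redirect.
      reaches-maximal : ∀ x → Reaches 4 x q
      reaches-maximal x with absorb x
      ... | p , p∈Q , R with twin? p∈Q
      reaches-maximal x | p , p∈Q , R | inj₁ R′ = reaches-trans R R′
      reaches-maximal x | p , p∈Q , stop | inj₂ p≼q = twin-reaches p∈Q p≼q
      reaches-maximal x | p , p∈Q , step x→p stop | inj₂ p≼q = step (p≼q _ x→p) stop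
      reaches-maximal x | p , p∈Q , step x→a (step a→p stop) | inj₂ p≼q =
        step x→a (step (p≼q _ a→p) stop)

    universalTarget : (∀ x → ∃[ y ] Arc D x y) → Vertex D → ∃[ q ] (∀ x → Reaches 4 x q)
    universalTarget noSink v with quasiKernel loopless (allFin _) (<-wellFounded _)
    -- The vertex `v` serves to show that `Q` is nonempty: something in `Q` must absorb it.
    ... | [] , _ , _ , absorb with absorb (∈-allFin v)
    ...   | ()
    universalTarget noSink v | p ∷ Q , _ , indep , absorb
      with maximal _≼?_ (λ _ y→u → y→u) (λ u≼v v≼w y y→u → v≼w y (u≼v y y→u)) p Q
    ... | q , q∈Q , q-max =
      q , reaches-maximal noSink
            (λ p∈Q q∈Q → nonadjacent⇒class≡ (indep p∈Q q∈Q) (indep q∈Q p∈Q))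
            (λ x → absorb (∈-allFin x)) q∈Q q-max

    -- Every vertex outside the class of a sink has an arc to it. Inside that class, any
    -- out-neighbour of `x` lies outside.
    reaches-sink : ∀ {s} → IsSink s → ∀ {x} → ¬ IsSink x → Reaches 2 x s
    reaches-sink {s} sink {x} ¬sink with class s Fin.≟ class x
    ... | no cs≢cx = step (¬arc⇒arc cs≢cx (sink x)) stop
    ... | yes cs≡cx with nonSink⇒arc ¬sink
    ... | y , x→y =
      step x→y (step (¬arc⇒arc (λ cs≡cy → arc⇒class≢ x→y (trans (sym cs≡cx) cs≡cy)) (sink y)) stop)

-- From bounded walks to kernels

module _ (H D : Digraph) (ρ : Coloring H D) where

  -- The right-hand side counts the arcs of `a ◅ W`. The walk must be nonempty, as the trivial walk
  -- has H-length 1 but no arc.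
  hLength-≤ : ∀ {x y z} (a : Arc D x y) (W : Walk D y z) →
              hLength H D ρ (a ◅ W) ≤ length (vertices D W)
  hLength-≤ a ε       = ≤-refl
  hLength-≤ a (b ◅ W) with arc? H (ρ a) (ρ b)
  ... | true  rewrite length-map suc (obstructions H D ρ (b ◅ W)) = m≤n⇒m≤1+n (hLength-≤ b W)
  ... | false rewrite length-map suc (obstructions H D ρ (b ◅ W)) = s≤s (hLength-≤ b W)

  reaches⇒hLength≤ : ∀ {n x y} → x ≢ y → Reaches D n x y →
                     ∃[ P ] IsPath D {x} {y} P × hLength H D ρ P ≤ n
  reaches⇒hLength≤ x≢y R with reaches⇒path D R
  ... | ε     , _      , _         = contradiction refl x≢y
  ... | a ◅ W , isPath , s≤s ∣W∣≤n = a ◅ W , isPath , ≤-trans (hLength-≤ a W) ∣W∣≤n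

  ∅-kernel : ∀ {k} → ¬ Vertex D → IsKernel H D ρ k ⊥
  ∅-kernel empty = record
    { independent = λ u∈⊥ → contradiction u∈⊥ ∉⊥
    ; absorbent   = λ {x} _ → contradiction x empty
    }

  singleton-kernel : ∀ {k q} → (∀ x → Reaches D (k ∸ 1) x q) → IsKernel H D ρ k ⁅ q ⁆
  singleton-kernel {q = q} reach = record
    { independent = λ u∈ v∈ u≢v → contradiction (trans (x∈⁅y⁆⇒x≡y q u∈) (sym (x∈⁅y⁆⇒x≡y q v∈))) u≢v
    ; absorbent   = λ {x} x∉ →
        q , x∈⁅x⁆ q , reaches⇒hLength≤ (λ { refl → x∉ (x∈⁅x⁆ q) }) (reach x)
    }

  -- No arc leaves a sink, so no walk joins two distinct sinks; the one sink `s` absorbs all other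
  -- vertices.
  sink-kernel : ∀ {k s} → IsSink D s → (∀ {x} → ¬ IsSink D x → Reaches D (k ∸ 1) x s) →
                IsKernel H D ρ k (proj₁ (comprehension (sink? D)))
  sink-kernel {k} {s} sink reach = record
    { independent = indep
    ; absorbent   = λ x∉ → s , complete sink ,
        reaches⇒hLength≤ (λ { refl → x∉ (complete sink) }) (reach (x∉ ∘ complete))
    }
    where
    sound    = proj₁ (proj₂ (comprehension (sink? D)))
    complete = proj₂ (proj₂ (comprehension (sink? D)))

    indep : ∀ {u v} → u ∈ _ → v ∈ _ → u ≢ v →
            (P : Walk D u v) → IsPath D P → k ≤ hLength H D ρ P
    indep _  _ u≢u ε       _ = contradiction refl u≢u
    indep u∈ _ _   (a ◅ _) _ = contradiction a (sound u∈ _)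

theorem25 : (r : ℕ) → r ≥ 2 → (H D : Digraph) → IsPartiteTournament r D →
    (ρ : Coloring H D) → (k : ℕ) → k ≥ 5 → HasKernel H D ρ k
theorem25 r r≥2 H D M ρ k k≥5 with Fin.any? (sink? D)
... | yes (s , sink) = _ , sink-kernel H D ρ sink
        (reaches-mono D (≤-trans (s≤s (s≤s z≤n)) (∸-monoˡ-≤ 1 k≥5)) ∘ reaches-sink D M sink)
... | no ∄sink with Fin.any? {n = order D} {P = λ _ → ⊤} (λ _ → yes tt)
...   | no ∄vertex  = _ , ∅-kernel H D ρ (λ v → ∄vertex (v , tt))
...   | yes (v , _) with universalTarget D M (λ x → nonSink⇒arc D (λ sink → ∄sink (x , sink))) v
-- From `k ≥ 5` comes `4 ≤ k ∸ 1`, which matches the four arcs of `universalTarget`.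
...     | q , reach = _ , singleton-kernel H D ρ (reaches-mono D (∸-monoˡ-≤ 1 k≥5) ∘ reach)
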